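{- For every integer $n\ge 0$, $$|RAI_{2n}(3412)|=|AI_{2n+2}(3412)|=|AI_{2n+1}(3412)|=|RAI_{2n+1}(3412)|=M_n,$$ where $M_n$ is the $n$-th Motzkin number.
   Context: Let $S_n$ be the set of permutations $\pi=\pi_1\ldots\pi_n$ of $\{1,\ldots,n\}$ (for $n=0$, only the empty permutation). A permutation is alternating if, for all $1\le i\le n-1$, $\pi_i<\pi_{i+1}$ if and only if $i$ is odd; it is reverse alternating if, for all $1\le i\le n-1$, $\pi_i>\pi_{i+1}$ if and only if $i$ is odd. $AI_n$ (resp. $RAI_n$) is the set of alternating (resp. reverse alternating) involutions ($\pi=\pi^{ -1}$) in $S_n$. A permutation $\pi\in S_n$ avoids the pattern $\tau\in S_k$ if there are no indices $i_1<\cdots<i_k$ such that $\pi_{i_1}\ldots\pi_{i_k}$ is order-isomorphic to $\tau$; $AI_n(\tau)$ and $RAI_n(\tau)$ are the subsets of elements avoiding $\tau$. The Motzkin number $M_n$ is the number of Motzkin paths of length $n$, i.e. lattice paths from $(0,0)$ to $(n,0)$ with steps $U=(1,1)$, $D=(1,-1)$, $H=(1,0)$ that stay weakly above the $x$-axis (so $M_0=M_1=1$, $M_2=2$, $M_3=4$). -}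

module Defs where

open import Data.Fin.Base using (Fin; toℕ; _<_)
open import Data.Fin.Patterns using (0F; 1F; 2F; 3F)
open import Data.Fin.Permutation
  using (Permutation′; permutation; _⟨$⟩ʳ_; _≈_; flip)
open import Data.List.Base using (List; []; _∷_; [_]; length; filter; cartesianProductWith)
open import Data.Nat.Base using (ℕ; zero; suc; parity)
open import Data.Parity.Base using (1ℙ)
open import Data.Product.Base using (Σ-syntax; _×_; proj₁)
open import Data.Vec.Base as Vec using (Vec; []; _∷_)
open import Function.Bundles using (Inverse; _⇔_)
open import Level using (Level; 0ℓ; _⊔_)
open import Relation.Binary.Bundles using (Setoid)
import Relation.Binary.Construct.On as On
open import Relation.Binary.PropositionalEquality
  using (_≡_; refl; sym; trans) renaming (setoid to ≡-setoid)
open import Relation.Nullary using (¬_; yes; no)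
open import Relation.Nullary.Decidable using (map′)
open import Relation.Unary using (Pred; Decidable; _∩_)

private
  variable
    a ℓ : Level
    k n : ℕ

-- The library's equality of permutations is pointwise.
Sₙ : ℕ → Setoid 0ℓ 0ℓ
Sₙ n = record
  { Carrier       = Permutation′ n
  ; _≈_           = _≈_
  ; isEquivalence = record
    { refl  = λ _ → refl
    ; sym   = λ p i → sym (p i)
    ; trans = λ p q i → trans (p i) (q i)
    }
  }

-- Two elements of the subset are equal when the underlying permutations are,
-- whatever the membership proofs.
Subset : (n : ℕ) → Pred (Permutation′ n) 0ℓ → Setoid 0ℓ 0ℓ
Subset n P = On.setoid {B = Σ[ π ∈ Permutation′ n ] P π} (Sₙ n) proj₁

∣_∣≡_ : Setoid a ℓ → ℕ → Set (a ⊔ ℓ)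
∣ A ∣≡ k = Inverse A (≡-setoid (Fin k))

infix 4 ∣_∣≡_

Odd : ℕ → Set
Odd m = parity m ≡ 1ℙ

-- Positions in Fin n count from 0, so i : Fin n is the position suc (toℕ i) of
-- the usual one-line notation π₁…πₙ.
Alternating : Pred (Permutation′ n) 0ℓ
Alternating {n} π = (i j : Fin n) → toℕ j ≡ suc (toℕ i) →
  (π ⟨$⟩ʳ i < π ⟨$⟩ʳ j) ⇔ Odd (suc (toℕ i))

ReverseAlternating : Pred (Permutation′ n) 0ℓ
ReverseAlternating {n} π = (i j : Fin n) → toℕ j ≡ suc (toℕ i) →
  (π ⟨$⟩ʳ j < π ⟨$⟩ʳ i) ⇔ Odd (suc (toℕ i))

-- flip is the inverse permutation.
Involution : Pred (Permutation′ n) 0ℓ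
Involution π = π ≈ flip π

Contains : Permutation′ k → Pred (Permutation′ n) 0ℓ
Contains {k} {n} τ π = Σ[ ι ∈ (Fin k → Fin n) ]
  ((∀ {r s : Fin k} → r < s → ι r < ι s) ×
   ((r s : Fin k) → (π ⟨$⟩ʳ ι r < π ⟨$⟩ʳ ι s) ⇔ (τ ⟨$⟩ʳ r < τ ⟨$⟩ʳ s)))

Avoids : Permutation′ k → Pred (Permutation′ n) 0ℓ
Avoids τ π = ¬ Contains τ π

AI : (n : ℕ) → Permutation′ k → Setoid 0ℓ 0ℓ
AI n τ = Subset n (Alternating ∩ Involution ∩ Avoids τ)

RAI : (n : ℕ) → Permutation′ k → Setoid 0ℓ 0ℓ
RAI n τ = Subset n (ReverseAlternating ∩ Involution ∩ Avoids τ)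

-- Values are shifted down by one, since Fin 4 starts at 0.
3412-pattern : Permutation′ 4
3412-pattern = permutation f f f∘f f∘f
  where
  f : Fin 4 → Fin 4
  f = Vec.lookup (2F ∷ 3F ∷ 0F ∷ 1F ∷ [])

  f∘f : ∀ i → f (f i) ≡ i
  f∘f 0F = refl
  f∘f 1F = refl
  f∘f 2F = refl
  f∘f 3F = refl

data Step : Set where
  U D H : Step

-- PathFrom h w: the lattice path that starts at height h and follows the steps
-- w stays weakly above the axis and ends on it.  Heights being natural numbers,
-- a down step is only possible from a positive height.
data PathFrom : ℕ → ∀ {n} → Vec Step n → Set where
  end  : PathFrom 0 []
  up   : ∀ {h n} {w : Vec Step n} → PathFrom (suc h) w → PathFrom h (U ∷ w)
  down : ∀ {h n} {w : Vec Step n} → PathFrom h w → PathFrom (suc h) (D ∷ w)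
  flat : ∀ {h n} {w : Vec Step n} → PathFrom h w → PathFrom h (H ∷ w)

IsMotzkin : Pred (Vec Step n) 0ℓ
IsMotzkin = PathFrom 0

pathFrom? : ∀ h → Decidable (PathFrom h {n})
pathFrom? zero    []      = yes end
pathFrom? (suc h) []      = no λ ()
pathFrom? h       (U ∷ w) = map′ up (λ { (up p) → p }) (pathFrom? (suc h) w)
pathFrom? zero    (D ∷ w) = no λ ()
pathFrom? (suc h) (D ∷ w) = map′ down (λ { (down p) → p }) (pathFrom? h w)
pathFrom? h       (H ∷ w) = map′ flat (λ { (flat p) → p }) (pathFrom? h w)

isMotzkin? : Decidable (IsMotzkin {n})
isMotzkin? = pathFrom? 0

-- Every word of n steps, each exactly once.
stepWords : (n : ℕ) → List (Vec Step n)
stepWords zero    = [ [] ]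
stepWords (suc n) = cartesianProductWith _∷_ (U ∷ D ∷ H ∷ []) (stepWords n)

motzkin : ℕ → ℕ
motzkin n = length (filter isMotzkin? (stepWords n))

{-# OPTIONS --safe #-}
module Submission where

-- An involution avoids 3412 exactly when the arcs joining i to π i do not cross, so it is
-- determined by the Motzkin path with U at the openers, D at the closers and H at the fixed
-- points.  Noncrossing makes descents local: π i > π (i + 1) if and only if step i is U or
-- step i + 1 is D.  Hence in the reverse alternating case steps at odd positions are U or H,
-- those at even positions D or H, and the consecutive pairs (odd, even) are UD, UH or HD;
-- reading these as H, U and D gives an arbitrary Motzkin path.  Odd length appends a final H,
-- and the alternating case prepends an H.

open import Defs
open import Data.Fin.Base as Fin using (Fin; zero; suc; toℕ; fromℕ<)
open import Data.Fin.Induction using (<-wellFounded)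
open import Data.Fin.Patterns using (0F; 1F; 2F; 3F)
open import Data.Fin.Permutation
  using (Permutation′; permutation; _⟨$⟩ʳ_; inverseʳ)
open import Data.Fin.Properties
  using (toℕ<n; toℕ-injective; toℕ-fromℕ<; fromℕ<-toℕ)
open import Data.List.Base as List using (List; []; _∷_)
open import Data.List.Membership.Propositional using (_∈_)
open import Data.List.Membership.Propositional.Properties
  using (∈-cartesianProductWith⁺; ∈-filter⁺; ∈-filter⁻; ∈-lookup)
open import Data.List.Relation.Unary.All as All using ([]; _∷_)
open import Data.List.Relation.Unary.AllPairs using ([]; _∷_)
open import Data.List.Relation.Unary.Any using (here; there; index)
open import Data.List.Relation.Unary.Any.Properties using (lookup-index)
open import Data.List.Relation.Unary.Unique.Propositional using (Unique)
import Data.List.Relation.Unary.Unique.Propositional.Properties as Unique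
open import Data.Nat.Base
  using (ℕ; zero; suc; _+_; _*_; _≤_; _<_; z≤n; s≤s; parity)
open import Data.Nat.Properties
open import Data.Parity.Base using (Parity; 0ℙ; 1ℙ; _⁻¹)
open import Data.Parity.Properties using (suc-homo-⁻¹; p≢p⁻¹; ⁻¹-selfInverse)
open import Data.Product.Base using (Σ-syntax; ∃-syntax; _×_; _,_; proj₁; proj₂)
open import Data.Sum.Base using (_⊎_; inj₁; inj₂; [_,_]; swap)
open import Data.Unit.Base using (⊤; tt)
open import Data.Vec.Base using (Vec; []; _∷_; lookup; tabulate)
open import Data.Vec.Properties
  using (∷-injective; ∷-injectiveʳ; lookup∘tabulate; tabulate∘lookup; tabulate-cong)
open import Function.Base using (_∘_; id; const)
open import Function.Bundles using (Bijection; Equivalence; _⇔_; mk⇔)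
open import Function.Construct.Composition using (_⇔-∘_; inverse; bijection)
open import Function.Construct.Symmetry using (⇔-sym)
import Function.Construct.Symmetry as Symmetry
open import Function.Properties.Bijection using (Bijection⇒Inverse)
open import Induction.WellFounded using (Acc; acc)
open import Level using (0ℓ)
open import Relation.Binary.Bundles using (Setoid)
open import Relation.Binary.Definitions using (tri<; tri≈; tri>)
import Relation.Binary.Construct.On as On
open import Relation.Binary.PropositionalEquality
  using (_≡_; _≢_; refl; sym; trans; cong; subst; subst₂) renaming (setoid to ≡-setoid)
open import Relation.Nullary using (¬_; yes; no; contradiction)
open import Relation.Unary using (Pred; _∩_)

private
  variable
    k n m : ℕ

Words : (n : ℕ) → Pred (Vec Step n) 0ℓ → Setoid 0ℓ 0ℓ
Words n Q = On.setoid {B = Σ[ w ∈ Vec Step n ] Q w} (≡-setoid (Vec Step n)) proj₁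

-- Counting Motzkin words

∈-stepWords : (w : Vec Step n) → w ∈ stepWords n
∈-stepWords []      = here refl
∈-stepWords (x ∷ w) = ∈-cartesianProductWith⁺ _∷_ (∈-steps x) (∈-stepWords w)
  where
  ∈-steps : ∀ x → x ∈ (U ∷ D ∷ H ∷ [])
  ∈-steps U = here refl
  ∈-steps D = there (here refl)
  ∈-steps H = there (there (here refl))

stepWords-unique : ∀ n → Unique (stepWords n)
stepWords-unique zero    = [] ∷ []
stepWords-unique (suc n) =
  Unique.cartesianProductWith⁺ _∷_ ∷-injective steps-unique (stepWords-unique n)
  where
  steps-unique : Unique (U ∷ D ∷ H ∷ [])
  steps-unique = ((λ ()) ∷ (λ ()) ∷ []) ∷ ((λ ()) ∷ []) ∷ [] ∷ []

lookup-injective : ∀ {A : Set} {xs : List A} → Unique xs →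
                   ∀ i j → List.lookup xs i ≡ List.lookup xs j → i ≡ j
lookup-injective (_ ∷ _)  zero    zero    _  = refl
lookup-injective (p ∷ _)  zero    (suc j) eq = contradiction eq (All.lookup p (∈-lookup j))
lookup-injective (p ∷ _)  (suc i) zero    eq = contradiction (sym eq) (All.lookup p (∈-lookup i))
lookup-injective (_ ∷ ps) (suc i) (suc j) eq = cong suc (lookup-injective ps i j eq)

-- `stepWords` lists each word exactly once and filtering preserves this, so positions in the
-- filtered list enumerate the Motzkin words.
index-Motzkin : ∀ n → Bijection (≡-setoid (Fin (motzkin n))) (Words n IsMotzkin)
index-Motzkin n = record
  { to        = λ i → List.lookup paths i , proj₂ (∈-filter⁻ isMotzkin? {xs = stepWords n} (∈-lookup i))
  ; cong      = cong (List.lookup paths)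
  ; bijective = (λ {i} {j} → lookup-injective (Unique.filter⁺ isMotzkin? (stepWords-unique n)) i j)
              , λ (w , p) → let w∈ = ∈-filter⁺ isMotzkin? (∈-stepWords w) p in
                  index w∈ , λ { refl → sym (lookup-index w∈) }
  }
  where
  paths : List (Vec Step n)
  paths = List.filter isMotzkin? (stepWords n)

-- Words of descents

-- The local criterion for a drop between adjacent positions of a noncrossing involution.
Descent : Step → Step → Set
Descent x y = x ≡ U ⊎ y ≡ D

-- Positions count from 0, so `0ℙ` corresponds to reverse alternating involutions and `1ℙ` to
-- alternating ones.
Falls : Parity → Pred (Vec Step n) 0ℓ
Falls {n} p w = (i j : Fin n) → toℕ j ≡ suc (toℕ i) →
  Descent (lookup w i) (lookup w j) ⇔ parity (toℕ i) ≡ p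

FallsFirst : Parity → Step → Pred (Vec Step n) 0ℓ
FallsFirst p x []      = ⊤
FallsFirst p x (y ∷ w) = Descent x y ⇔ 0ℙ ≡ p

parity-suc : ∀ i p → parity (suc i) ≡ p ⇔ parity i ≡ p ⁻¹
parity-suc i p = mk⇔
  (λ eq → trans (sym (suc-homo-⁻¹ i)) (cong _⁻¹ eq))
  (λ eq → trans (sym (⁻¹-selfInverse (suc-homo-⁻¹ i))) (⁻¹-selfInverse (sym eq)))

falls-∷ : ∀ {p x} {w : Vec Step n} → FallsFirst p x w → Falls (p ⁻¹) w → Falls p (x ∷ w)
falls-∷ {w = _ ∷ _} first _ zero (suc zero) _ = first
falls-∷ {p = p} _ rest (suc i) (suc j) eq =
  ⇔-sym (parity-suc (toℕ i) p) ⇔-∘ rest i j (suc-injective eq)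

falls-first : ∀ {p x} {w : Vec Step n} → Falls p (x ∷ w) → FallsFirst p x w
falls-first {w = []}    _ = tt
falls-first {w = _ ∷ _} f = f 0F 1F refl

falls-rest : ∀ {p x} {w : Vec Step n} → Falls p (x ∷ w) → Falls (p ⁻¹) w
falls-rest {p = p} f i j eq = parity-suc (toℕ i) p ⇔-∘ f (suc i) (suc j) (cong suc eq)

NotDown : Pred (Vec Step n) 0ℓ
NotDown []      = ⊤
NotDown (x ∷ _) = x ≢ D

rises : ∀ {x} (w : Vec Step n) → x ≢ U → NotDown w → FallsFirst 1ℙ x w
rises []      _   _   = tt
rises (y ∷ w) x≢U y≢D = mk⇔ (λ { (inj₁ x≡U) → contradiction x≡U x≢U
                                ; (inj₂ y≡D) → contradiction y≡D y≢D }) λ ()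

rises⇒notDown : ∀ {x} (w : Vec Step n) → FallsFirst 1ℙ x w → NotDown w
rises⇒notDown []      _ = tt
rises⇒notDown (y ∷ w) r y≡D with () ← Equivalence.to r (inj₂ y≡D)

-- The positive height guarantees that a further step exists; a `U` before it would be a forbidden
-- descent.
rises⇒notUp : ∀ {x h} {w : Vec Step n} → PathFrom (suc h) w → FallsFirst 1ℙ x w → x ≢ U
rises⇒notUp {w = _ ∷ _} _ r x≡U with () ← Equivalence.to r (inj₁ x≡U)

motzkin⇒notDown : {w : Vec Step n} → IsMotzkin w → NotDown w
motzkin⇒notDown end      = tt
motzkin⇒notDown (up _)   = λ ()
motzkin⇒notDown (flat _) = λ ()

-- Doubling Motzkin paths

2*_+′_ : ℕ → ℕ → ℕ
2* zero  +′ k = k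
2* suc n +′ k = suc (suc (2* n +′ k))

data Tail : Vec Step k → Set where
  even : Tail []
  odd  : Tail (H ∷ [])

-- The length `2* n +′ k` unfolds by two successors at a time, so the clauses need no transport.
expand : Vec Step n → Vec Step k → Vec Step (2* n +′ k)
expand []      t = t
expand (U ∷ w) t = U ∷ H ∷ expand w t
expand (D ∷ w) t = H ∷ D ∷ expand w t
expand (H ∷ w) t = U ∷ D ∷ expand w t

expand-injective : ∀ (v w : Vec Step n) (t : Vec Step k) → expand v t ≡ expand w t → v ≡ w
expand-injective []      []      t _  = refl
expand-injective (U ∷ v) (U ∷ w) t eq = cong (U ∷_) (expand-injective v w t (∷-injectiveʳ (∷-injectiveʳ eq)))
expand-injective (D ∷ v) (D ∷ w) t eq = cong (D ∷_) (expand-injective v w t (∷-injectiveʳ (∷-injectiveʳ eq)))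
expand-injective (H ∷ v) (H ∷ w) t eq = cong (H ∷_) (expand-injective v w t (∷-injectiveʳ (∷-injectiveʳ eq)))
expand-injective (U ∷ v) (D ∷ w) t ()
expand-injective (U ∷ v) (H ∷ w) t ()
expand-injective (D ∷ v) (U ∷ w) t ()
expand-injective (D ∷ v) (H ∷ w) t ()
expand-injective (H ∷ v) (U ∷ w) t ()
expand-injective (H ∷ v) (D ∷ w) t ()

expand-path : ∀ {h} {w : Vec Step n} {t : Vec Step k} → Tail t →
              PathFrom h w → PathFrom h (expand w t)
expand-path even end      = end
expand-path odd  end      = flat end
expand-path τ    (up p)   = up (flat (expand-path τ p))
expand-path τ    (down p) = flat (down (expand-path τ p))
expand-path τ    (flat p) = up (down (expand-path τ p))

expand-notDown : ∀ (w : Vec Step n) {t : Vec Step k} → Tail t → NotDown (expand w t)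
expand-notDown []      even = tt
expand-notDown []      odd  = λ ()
expand-notDown (U ∷ w) _    = λ ()
expand-notDown (D ∷ w) _    = λ ()
expand-notDown (H ∷ w) _    = λ ()

-- Each pair is a descent. Between pairs there is none: a pair ends in `H` or `D`, and what follows
-- begins with `U` or `H`.
expand-falls : ∀ (w : Vec Step n) {t : Vec Step k} → Tail t → Falls 0ℙ (expand w t)
expand-falls (x ∷ w) {t} τ = go x
  where
  second : ∀ {y} → y ≢ U → Falls 1ℙ (y ∷ expand w t)
  second y≢U = falls-∷ (rises _ y≢U (expand-notDown w τ)) (expand-falls w τ)

  go : ∀ x → Falls 0ℙ (expand (x ∷ w) t)
  go U = falls-∷ (mk⇔ (const refl) (const (inj₁ refl))) (second λ ())
  go D = falls-∷ (mk⇔ (const refl) (const (inj₂ refl))) (second λ ())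
  go H = falls-∷ (mk⇔ (const refl) (const (inj₁ refl))) (second λ ())
expand-falls [] even = λ ()
expand-falls [] odd  = λ { zero zero () }

-- Each pair must be a descent, which without a leading `D` leaves `UD`, `UH`, `HD` and the excluded
-- `UU`. The condition `NotDown` holds at the start because the path begins on the axis, and later
-- because no descent is allowed between pairs.
unexpand : ∀ n {h} {t : Vec Step k} → Tail t → (u : Vec Step (2* n +′ k)) →
           PathFrom h u → NotDown u → Falls 0ℙ u →
           Σ[ w ∈ Vec Step n ] PathFrom h w × expand w t ≡ u
unexpand-rest : ∀ n {h x y} {t : Vec Step k} → Tail t → (u : Vec Step (2* n +′ k)) →
                PathFrom h u → Falls 0ℙ (x ∷ y ∷ u) →
                Σ[ w ∈ Vec Step n ] PathFrom h w × expand w t ≡ u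

unexpand zero    even []          end        _  _ = [] , end , refl
unexpand zero    odd  (_ ∷ [])    (flat end) _  _ = [] , end , refl
unexpand zero    odd  (_ ∷ [])    (up ())
unexpand zero    odd  (_ ∷ [])    (down _)   nd _ = contradiction refl nd
unexpand (suc n) τ    (D ∷ _ ∷ u) _          nd _ = contradiction refl nd
-- The path is still above the axis, so a step follows, and the second `U` would make a descent at
-- an odd position.
unexpand (suc n) τ    (U ∷ U ∷ u) (up (up p)) _ f =
  contradiction refl (rises⇒notUp p (falls-first (falls-rest f)))
unexpand (suc n) τ    (U ∷ D ∷ u) (up (down p)) _ f with unexpand-rest n τ u p f
... | w , q , refl = H ∷ w , flat q , refl
unexpand (suc n) τ    (U ∷ H ∷ u) (up (flat p)) _ f with unexpand-rest n τ u p f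
... | w , q , refl = U ∷ w , up q , refl
unexpand (suc n) τ    (H ∷ D ∷ u) (flat (down p)) _ f with unexpand-rest n τ u p f
... | w , q , refl = D ∷ w , down q , refl
unexpand (suc n) τ    (H ∷ U ∷ u) _ _ f with Equivalence.from (falls-first f) refl
... | inj₁ ()
... | inj₂ ()
unexpand (suc n) τ    (H ∷ H ∷ u) _ _ f with Equivalence.from (falls-first f) refl
... | inj₁ ()
... | inj₂ ()

unexpand-rest n τ u p f = unexpand n τ u p
  (rises⇒notDown u (falls-first (falls-rest f))) (falls-rest (falls-rest f))

expand-bijection : ∀ n {t : Vec Step k} → Tail t →
  Bijection (Words n IsMotzkin) (Words (2* n +′ k) (IsMotzkin ∩ Falls 0ℙ))
expand-bijection n {t} τ = record
  { to        = λ (w , p) → expand w t , expand-path τ p , expand-falls w τ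
  ; cong      = cong (λ w → expand w t)
  ; bijective = (λ {(v , _)} {(w , _)} → expand-injective v w t)
              , λ (u , p , f) → let (w , q , eq) = unexpand n τ u p (motzkin⇒notDown p) f in
                  (w , q) , λ { refl → eq }
  }

-- A leading `U` would be a descent at position 0, which `1ℙ` forbids, and `D` cannot leave the
-- axis. So the first step is `H`, and removing it flips the parity.
prepend-bijection : ∀ n →
  Bijection (Words n (IsMotzkin ∩ Falls 0ℙ)) (Words (suc n) (IsMotzkin ∩ Falls 1ℙ))
prepend-bijection n = record
  { to        = λ (w , p , f) → H ∷ w , flat p , falls-∷ (rises w (λ ()) (motzkin⇒notDown p)) f
  ; cong      = cong (H ∷_)
  ; bijective = ∷-injectiveʳ , surj
  }
  where
  surj : ∀ ((u , _) : Σ[ u ∈ Vec Step (suc n) ] (IsMotzkin ∩ Falls 1ℙ) u) →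
         Σ[ (w , _) ∈ Σ[ w ∈ Vec Step n ] (IsMotzkin ∩ Falls 0ℙ) w ] (∀ {z} → proj₁ z ≡ w → H ∷ proj₁ z ≡ u)
  surj (U ∷ _ , up p   , f) = contradiction refl (rises⇒notUp p (falls-first f))
  surj (H ∷ w , flat p , f) = (w , p , falls-rest f) , λ { refl → refl }

-- Heights of a path

data Move : Step → ℕ → ℕ → Set where
  rise : ∀ {h} → Move U h (suc h)
  fall : ∀ {h} → Move D (suc h) h
  stay : ∀ {h} → Move H h h

-- Heights are natural numbers, so staying weakly above the axis is built into `Move`.
pathFromHeights : (w : Vec Step n) (h : ℕ → ℕ) →
  (∀ i → Move (lookup w i) (h (toℕ i)) (h (suc (toℕ i)))) → h n ≡ 0 → PathFrom (h 0) w
pathFromHeights []      h _     h≡0 = subst (λ x → PathFrom x []) (sym h≡0) end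
pathFromHeights (x ∷ w) h moves h≡0 =
  step (moves zero) (pathFromHeights w (h ∘ suc) (moves ∘ suc) h≡0)
  where
  step : ∀ {x a b} → Move x a b → PathFrom b w → PathFrom a (x ∷ w)
  step rise = up
  step fall = down
  step stay = flat

-- The value 0 past the end makes heights total on ℕ, so that arcs can be treated without bounds.
height : ∀ {h} {w : Vec Step n} → PathFrom h w → ℕ → ℕ
height {h = h} _ zero   = h
height end      (suc i) = 0
height (up p)   (suc i) = height p i
height (down p) (suc i) = height p i
height (flat p) (suc i) = height p i

height-move : ∀ {h} {w : Vec Step n} (p : PathFrom h w) (i : Fin n) →
              Move (lookup w i) (height p (toℕ i)) (height p (suc (toℕ i)))
height-move (up p)   zero    = rise
height-move (down p) zero    = fall
height-move (flat p) zero    = stay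
height-move (up p)   (suc i) = height-move p i
height-move (down p) (suc i) = height-move p i
height-move (flat p) (suc i) = height-move p i

height-end : ∀ {h} {w : Vec Step n} (p : PathFrom h w) {i} → n ≤ i → height p i ≡ 0
height-end end      {zero}  _         = refl
height-end end      {suc i} _         = refl
height-end (up p)   {suc i} (s≤s n≤i) = height-end p n≤i
height-end (down p) {suc i} (s≤s n≤i) = height-end p n≤i
height-end (flat p) {suc i} (s≤s n≤i) = height-end p n≤i

-- Together with `height-≤suc`, the discrete continuity that makes `lastBelow` and `firstBelow` hit
-- a level exactly.
height-suc≤ : ∀ {h} {w : Vec Step n} (p : PathFrom h w) i → height p (suc i) ≤ suc (height p i)
height-suc≤ end      i       = z≤n
height-suc≤ (up p)   zero    = ≤-refl
height-suc≤ (down p) zero    = m≤n⇒m≤1+n (n≤1+n _)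
height-suc≤ (flat p) zero    = n≤1+n _
height-suc≤ (up p)   (suc i) = height-suc≤ p i
height-suc≤ (down p) (suc i) = height-suc≤ p i
height-suc≤ (flat p) (suc i) = height-suc≤ p i

height-≤suc : ∀ {h} {w : Vec Step n} (p : PathFrom h w) i → height p i ≤ suc (height p (suc i))
height-≤suc end      zero    = z≤n
height-≤suc end      (suc i) = z≤n
height-≤suc (up p)   zero    = m≤n⇒m≤1+n (n≤1+n _)
height-≤suc (down p) zero    = ≤-refl
height-≤suc (flat p) zero    = n≤1+n _
height-≤suc (up p)   (suc i) = height-≤suc p i
height-≤suc (down p) (suc i) = height-≤suc p i
height-≤suc (flat p) (suc i) = height-≤suc p i

-- Arcs under a path

module Arcs {m : ℕ} {w : Vec Step m} (p : IsMotzkin w) where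

  private
    h : ℕ → ℕ
    h = height p

  -- Up and down steps matched as parentheses: step `b` is the first to return to the height before
  -- step `a`.
  Arc : ℕ → ℕ → Set
  Arc a b = a < b × h a ≡ h (suc b) × (∀ x → a < x → x ≤ b → h a < h x)

  arc-rises : ∀ {a b} → Arc a b → h a < h (suc a)
  arc-rises (a<b , _ , above) = above _ ≤-refl a<b

  arc-falls : ∀ {a b} → Arc a b → h (suc b) < h b
  arc-falls {a} {b} (a<b , eq , above) = subst (_< h b) eq (above b a<b ≤-refl)

  -- With two different ends, the path would be back at level `h a` strictly inside the longer arc.
  arc-uniqueʳ : ∀ {a b c} → Arc a b → Arc a c → b ≡ c
  arc-uniqueʳ {a} {b} {c} (a<b , eq , above) (a<c , eq′ , above′) with <-cmp b c
  ... | tri< b<c _ _ = contradiction eq  (<⇒≢ (above′ (suc b) (m<n⇒m<1+n a<b) b<c))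
  ... | tri≈ _ b≡c _ = b≡c
  ... | tri> _ _ c<b = contradiction eq′ (<⇒≢ (above (suc c) (m<n⇒m<1+n a<c) c<b))

  arc-uniqueˡ : ∀ {a b c} → Arc a c → Arc b c → a ≡ b
  arc-uniqueˡ {a} {b} {c} (a<c , eq , above) (b<c , eq′ , above′) with <-cmp a b
  ... | tri< a<b _ _ = contradiction (trans eq (sym eq′)) (<⇒≢ (above b a<b (<⇒≤ b<c)))
  ... | tri≈ _ a≡b _ = a≡b
  ... | tri> _ _ b<a = contradiction (trans eq′ (sym eq)) (<⇒≢ (above′ a b<a (<⇒≤ a<c)))

  -- The first arc puts `h c` above `h a`, and the second would put `h (suc b)` above `h c`, yet
  -- `h (suc b)` equals `h a`.
  arcs-don't-cross : ∀ {a b c d} → Arc a b → Arc c d → a < c → c < b → ¬ b < d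
  arcs-don't-cross {a} {b} {c} {d} (_ , eq , above) (_ , _ , above′) a<c c<b b<d =
    <-irrefl eq (<-trans (above c a<c (<⇒≤ c<b)) (above′ (suc b) (m<n⇒m<1+n c<b) b<d))

  -- Going back from `k`, heights drop by at most one, so the first height not above `v` equals `v`.
  -- It exists because the path starts at height 0, which also leaves no case for `k` zero.
  lastBelow : ∀ v k → v < h k → ∃[ a ] a < k × h a ≡ v × (∀ x → a < x → x ≤ k → v < h x)
  lastBelow v (suc k) v<hk+1 with <-≤-connex v (h k)
  ... | inj₁ v<hk with a , a<k , eq , above ← lastBelow v k v<hk =
    a , m<n⇒m<1+n a<k , eq , above′
    where
    above′ : ∀ x → a < x → x ≤ suc k → v < h x
    above′ x a<x x≤ with m≤n⇒m<n∨m≡n x≤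
    ... | inj₁ x<1+k = above x a<x (≤-pred x<1+k)
    ... | inj₂ refl  = v<hk+1
  ... | inj₂ hk≤v =
    k , ≤-refl , ≤-antisym hk≤v (≤-pred (≤-trans v<hk+1 (height-suc≤ p k))) ,
    λ x k<x x≤ → subst (λ x → v < h x) (≤-antisym k<x x≤) v<hk+1

  inside : ∀ {k} → 0 < h k → k < m
  inside {k} 0<h = ≰⇒> λ m≤k → <-irrefl (sym (height-end p m≤k)) 0<h

  firstBelow : ∀ v k → v < h k → ∃[ b ] k ≤ b × h (suc b) ≡ v × (∀ x → k ≤ x → x ≤ b → v < h x)
  -- Fuel `m` suffices because all heights from `m` on are 0.
  firstBelow v k v<hk = go m k (m≤m+n m k) v<hk
    where
    go : ∀ fuel k → m ≤ fuel + k → v < h k →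
         ∃[ b ] k ≤ b × h (suc b) ≡ v × (∀ x → k ≤ x → x ≤ b → v < h x)
    go zero       k m≤ v<hk = contradiction (inside (≤-<-trans z≤n v<hk)) (≤⇒≯ m≤)
    go (suc fuel) k m≤ v<hk with <-≤-connex v (h (suc k))
    ... | inj₁ v<hk+1 with b , k<b , eq , above ← go fuel (suc k) (subst (m ≤_) (sym (+-suc fuel k)) m≤) v<hk+1 =
      b , <⇒≤ k<b , eq , above′
      where
      above′ : ∀ x → k ≤ x → x ≤ b → v < h x
      above′ x k≤x x≤b with m≤n⇒m<n∨m≡n k≤x
      ... | inj₁ k<x  = above x k<x x≤b
      ... | inj₂ refl = v<hk
    ... | inj₂ hk+1≤v =
      k , ≤-refl , ≤-antisym hk+1≤v (≤-pred (≤-trans v<hk (height-≤suc p k))) ,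
      λ x k≤x x≤k → subst (λ x → v < h x) (≤-antisym k≤x x≤k) v<hk

  data Partner (i j : ℕ) : Set where
    opens  : Arc i j → Partner i j
    closes : Arc j i → Partner i j
    fixed  : h i ≡ h (suc i) → i ≡ j → Partner i j

  partner-sym : ∀ {i j} → Partner i j → Partner j i
  partner-sym (opens arc)     = closes arc
  partner-sym (closes arc)    = opens arc
  partner-sym (fixed eq refl) = fixed eq refl

  -- Comparing `h i` with `h (suc i)` tells the three cases apart, and within each the arc is
  -- unique.
  partner-unique : ∀ {i j k} → Partner i j → Partner i k → j ≡ k
  partner-unique (opens a)      (opens b)      = arc-uniqueʳ a b
  partner-unique (opens a)      (closes b)     = contradiction (arc-rises a) (<-asym (arc-falls b))
  partner-unique (opens a)      (fixed eq _)   = contradiction eq (<⇒≢ (arc-rises a))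
  partner-unique (closes a)     (opens b)      = contradiction (arc-rises b) (<-asym (arc-falls a))
  partner-unique (closes a)     (closes b)     = arc-uniqueˡ a b
  partner-unique (closes a)     (fixed eq _)   = contradiction (sym eq) (<⇒≢ (arc-falls a))
  partner-unique (fixed eq _)   (opens b)      = contradiction eq (<⇒≢ (arc-rises b))
  partner-unique (fixed eq _)   (closes b)     = contradiction (sym eq) (<⇒≢ (arc-falls b))
  partner-unique (fixed _ refl) (fixed _ refl) = refl

  -- From a rising step, search forward for the return to `h i`; from a falling one, search back for
  -- the last visit to `h (suc i)`.
  partner : ∀ i → ∃[ j ] Partner i j
  partner i with <-cmp (h i) (h (suc i))
  ... | tri≈ _ eq _ = i , fixed eq refl
  ... | tri< lt _ _ with b , i<b , eq , above ← firstBelow (h i) (suc i) lt =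
    b , opens (i<b , sym eq , above)
  ... | tri> _ _ gt with a , a<i , eq , above ← lastBelow (h (suc i)) i gt =
    a , closes (a<i , eq , λ x a<x x≤i → subst (_< h x) (sym eq) (above x a<x x≤i))

  partner< : ∀ {i j} → i < m → Partner i j → j < m
  partner< _   (opens (a<b , _ , above)) = inside (≤-<-trans z≤n (above _ a<b ≤-refl))
  partner< i<m (closes (a<b , _))        = <-trans a<b i<m
  partner< i<m (fixed _ refl)            = i<m

  match : Fin m → Fin m
  match i = fromℕ< (partner< (toℕ<n i) (proj₂ (partner (toℕ i))))

  match-partner : ∀ i → Partner (toℕ i) (toℕ (match i))
  match-partner i = subst (Partner (toℕ i)) (sym (toℕ-fromℕ< _)) (proj₂ (partner (toℕ i)))

  match-involutive : ∀ i → match (match i) ≡ i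
  match-involutive i = toℕ-injective
    (partner-unique (match-partner (match i)) (partner-sym (match-partner i)))

  match-arc : ∀ i → toℕ i < toℕ (match i) → Arc (toℕ i) (toℕ (match i))
  match-arc i i<j with match-partner i
  ... | opens arc       = arc
  ... | closes (j<i , _) = contradiction i<j (<-asym j<i)
  ... | fixed _ i≡j     = contradiction i≡j (<⇒≢ i<j)

  matching : Permutation′ m
  matching = permutation match match match-involutive match-involutive

-- Words of involutions

letter : ℕ → ℕ → Step
letter i j with <-cmp i j
... | tri< _ _ _ = U
... | tri≈ _ _ _ = H
... | tri> _ _ _ = D

-- Applied both to a position and its image and to the heights around a step, so that `kind-unique`
-- can compare the two readings of a letter.
data Kind : Step → ℕ → ℕ → Set where
  opener : ∀ {i j} → i < j → Kind U i j
  closer : ∀ {i j} → j < i → Kind D i j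
  fixed  : ∀ {i j} → i ≡ j → Kind H i j

letter-kind : ∀ i j → Kind (letter i j) i j
letter-kind i j with <-cmp i j
... | tri< i<j _ _ = opener i<j
... | tri≈ _ i≡j _ = fixed i≡j
... | tri> _ _ j<i = closer j<i

kind-unique : ∀ {x y i j} → Kind x i j → Kind y i j → x ≡ y
kind-unique (opener _)   (opener _)   = refl
kind-unique (opener i<j) (closer j<i) = contradiction i<j (<-asym j<i)
kind-unique (opener i<j) (fixed i≡j)  = contradiction i≡j (<⇒≢ i<j)
kind-unique (closer j<i) (opener i<j) = contradiction i<j (<-asym j<i)
kind-unique (closer _)   (closer _)   = refl
kind-unique (closer j<i) (fixed i≡j)  = contradiction i≡j (>⇒≢ j<i)
kind-unique (fixed i≡j)  (opener i<j) = contradiction i≡j (<⇒≢ i<j)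
kind-unique (fixed i≡j)  (closer j<i) = contradiction i≡j (>⇒≢ j<i)
kind-unique (fixed _)    (fixed _)    = refl

move-kind : ∀ {x a b} → Move x a b → Kind x a b
move-kind rise = opener ≤-refl
move-kind fall = closer ≤-refl
move-kind stay = fixed refl

arcWord : (Fin m → Fin m) → Vec Step m
arcWord g = tabulate λ i → letter (toℕ i) (toℕ (g i))

arcWord-kind : ∀ (g : Fin m → Fin m) i → Kind (lookup (arcWord g) i) (toℕ i) (toℕ (g i))
arcWord-kind g i = subst (λ x → Kind x (toℕ i) (toℕ (g i)))
  (sym (lookup∘tabulate _ i)) (letter-kind (toℕ i) (toℕ (g i)))

arcWord-cong : ∀ {f g : Fin m → Fin m} → (∀ i → f i ≡ g i) → arcWord f ≡ arcWord g
arcWord-cong eq = tabulate-cong λ i → cong (λ j → letter (toℕ i) (toℕ j)) (eq i)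

-- The number of `a < k` with `t ≤ f a`. Threshold and range are separate so that they can be
-- advanced one at a time.
reaching : (ℕ → ℕ) → ℕ → ℕ → ℕ
reaching f t zero = 0
reaching f t (suc k) with t ≤? f k
... | yes _ = suc (reaching f t k)
... | no  _ = reaching f t k

module _ (f : ℕ → ℕ) where

  reaching-skip : ∀ t k → (∀ a → a < k → f a ≢ t) → reaching f t k ≡ reaching f (suc t) k
  reaching-skip t zero    _    = refl
  reaching-skip t (suc k) miss
    with reaching-skip t k (λ a a<k → miss a (m<n⇒m<1+n a<k)) | t ≤? f k | suc t ≤? f k
  ... | ih | yes _ | yes _  = cong suc ih
  ... | ih | no _  | no _   = ih
  ... | _  | yes t≤ | no t≮ = contradiction (≤-antisym (≮⇒≥ t≮) t≤) (miss k ≤-refl)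
  ... | _  | no t≰ | yes t< = contradiction (<⇒≤ t<) t≰

  -- Only `f t` has image `t`, so raising the threshold loses exactly that element; below it
  -- `reaching-skip` applies.
  reaching-hit : (∀ a → f (f a) ≡ a) → ∀ t k → f t < k → reaching f t k ≡ suc (reaching f (suc t) k)
  reaching-hit inv t (suc k) ft<1+k with m≤n⇒m<n∨m≡n (≤-pred ft<1+k)
  reaching-hit inv t (suc k) _ | inj₁ ft<k
    with reaching-hit inv t k ft<k | t ≤? f k | suc t ≤? f k
  ... | ih | yes _  | yes _ = cong suc ih
  ... | ih | no _   | no _  = ih
  ... | _  | yes t≤ | no t≮ =
    contradiction (trans (cong f (≤-antisym t≤ (≮⇒≥ t≮))) (inv k)) (<⇒≢ ft<k)
  ... | _  | no t≰  | yes t< = contradiction (<⇒≤ t<) t≰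
  reaching-hit inv t (suc .(f t)) _ | inj₂ refl with t ≤? f (f t) | suc t ≤? f (f t)
  ... | no t≰ | _      = contradiction (≤-reflexive (sym (inv t))) t≰
  ... | yes _ | yes t< = contradiction (inv t) (>⇒≢ t<)
  ... | yes _ | no _   = cong suc (reaching-skip t (f t)
    λ a a<ft fa≡t → <⇒≢ a<ft (trans (sym (inv a)) (cong f fa≡t)))

  reaching-none : ∀ t k → (∀ a → a < k → f a < t) → reaching f t k ≡ 0
  reaching-none t zero    _     = refl
  reaching-none t (suc k) below with t ≤? f k
  ... | yes t≤ = contradiction (below k ≤-refl) (≤⇒≯ t≤)
  ... | no _   = reaching-none t k (λ a a<k → below a (m<n⇒m<1+n a<k))

  -- Raising the threshold loses an element exactly when `f i < i`, and the new element `i` counts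
  -- exactly when `i < f i`.
  reaching-move : (∀ a → f (f a) ≡ a) → ∀ {x} i → Kind x i (f i) →
                  Move x (reaching f i i) (reaching f (suc i) (suc i))
  reaching-move inv {x} i kind with suc i ≤? f i
  reaching-move inv i (opener i<fi) | yes _ =
    subst (λ r → Move U r (suc (reaching f (suc i) i))) (sym (reaching-skip i i miss)) rise
    where
    miss : ∀ a → a < i → f a ≢ i
    miss a a<i fa≡i = <-asym a<i (subst (i <_) (trans (cong f (sym fa≡i)) (inv a)) i<fi)
  reaching-move inv i (opener i<fi) | no i≮ = contradiction i<fi i≮
  reaching-move inv i (closer fi<i) | yes i<fi = contradiction i<fi (<-asym fi<i)
  reaching-move inv i (closer fi<i) | no _ =
    subst (λ r → Move D r (reaching f (suc i) i)) (sym (reaching-hit inv i i fi<i)) fall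
  reaching-move inv i (fixed i≡fi) | yes i<fi = contradiction i≡fi (<⇒≢ i<fi)
  reaching-move inv i (fixed i≡fi) | no _ =
    subst (λ r → Move H r (reaching f (suc i) i)) (sym (reaching-skip i i miss)) stay
    where
    miss : ∀ a → a < i → f a ≢ i
    miss a a<i fa≡i = <⇒≢ a<i (trans (sym (inv a)) (trans (cong f fa≡i) (sym i≡fi)))

-- The identity outside the range keeps an involution an involution.
extend : (Fin m → Fin m) → ℕ → ℕ
extend {m} g k with k <? m
... | yes k<m = toℕ (g (fromℕ< k<m))
... | no  _   = k

extend-toℕ : ∀ (g : Fin m → Fin m) i → extend g (toℕ i) ≡ toℕ (g i)
extend-toℕ {m} g i with toℕ i <? m
... | yes i<m = cong (toℕ ∘ g) (fromℕ<-toℕ i i<m)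
... | no  i≮m = contradiction (toℕ<n i) i≮m

extend-≮ : ∀ (g : Fin m → Fin m) {k} → ¬ k < m → extend g k ≡ k
extend-≮ {m} g {k} k≮m with k <? m
... | yes k<m = contradiction k<m k≮m
... | no  _   = refl

extend-involutive : {g : Fin m → Fin m} → (∀ i → g (g i) ≡ i) → ∀ k → extend g (extend g k) ≡ k
extend-involutive {m} {g} inv k with k <? m
... | yes k<m = trans (extend-toℕ g _) (trans (cong toℕ (inv _)) (toℕ-fromℕ< k<m))
... | no  k≮m = extend-≮ g k≮m

extend-< : ∀ (g : Fin m → Fin m) k → k < m → extend g k < m
extend-< {m} g k k<m with k <? m
... | yes _   = toℕ<n _
... | no  k≮m = contradiction k<m k≮m

-- The height before position i is the number of arcs reaching from below i to i or above.
arcWord-motzkin : {g : Fin m → Fin m} → (∀ i → g (g i) ≡ i) → IsMotzkin (arcWord g)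
arcWord-motzkin {m} {g} inv = pathFromHeights (arcWord g) (λ i → reaching (extend g) i i)
  (λ i → reaching-move (extend g) (extend-involutive inv) (toℕ i)
    (subst (Kind _ (toℕ i)) (sym (extend-toℕ g i)) (arcWord-kind g i)))
  (reaching-none (extend g) m m (extend-< g))

-- Noncrossing involutions

NonCrossing : Pred (Fin m → Fin m) 0ℓ
NonCrossing g = ∀ a c → a Fin.< c → c Fin.< g a → ¬ g a Fin.< g c

module _ {g : Fin m → Fin m} (inv : ∀ i → g (g i) ≡ i) where

  involutive⇒injective : ∀ {i j} → g i ≡ g j → i ≡ j
  involutive⇒injective eq = trans (sym (inv _)) (trans (cong g eq) (inv _))

  module _ (nc : NonCrossing g) where

    -- The arc from `g j` to `j` encloses `a`, so an arc from `a` past `j` would cross it.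
    closer-outside : ∀ a j → g j Fin.< a → a Fin.< j → g a Fin.< j
    closer-outside a j gj<a a<j with <-cmp (toℕ (g a)) (toℕ j)
    ... | tri< ga<j _ _ = ga<j
    ... | tri≈ _ ga≡j _ = contradiction
      (cong toℕ (trans (cong g (sym (toℕ-injective ga≡j))) (inv a))) (<⇒≢ gj<a)
    ... | tri> _ _ j<ga = contradiction (subst (Fin._< g a) (sym (inv j)) j<ga)
      (nc (g j) a gj<a (subst (a Fin.<_) (sym (inv j)) a<j))

    module _ (i j : Fin m) (j≡1+i : toℕ j ≡ suc (toℕ i)) where

      i<j : i Fin.< j
      i<j = ≤-reflexive (sym j≡1+i)

      -- Either `j` lies under the arc from `i`, and a larger `g j` would give a crossing, or `j`
      -- closes that arc and `g j` is `i`.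
      drops-after-opener : i Fin.< g i → g j Fin.< g i
      drops-after-opener i<gi with <-cmp (toℕ (g j)) (toℕ (g i))
      ... | tri< lt _ _ = lt
      ... | tri≈ _ eq _ = contradiction
        (cong toℕ (involutive⇒injective (toℕ-injective eq))) (>⇒≢ i<j)
      ... | tri> _ _ gi<gj with m≤n⇒m<n∨m≡n (subst (_≤ toℕ (g i)) (sym j≡1+i) i<gi)
      ...   | inj₁ j<gi = contradiction gi<gj (nc i j i<j j<gi)
      ...   | inj₂ j≡gi = subst (Fin._< g i)
        (trans (sym (inv i)) (cong g (sym (toℕ-injective j≡gi)))) i<gi

      -- If `g j` is `i`, then `g i` is `j`. Otherwise `g j < i`, and `g i < g j` would make the
      -- arcs ending at `i` and `j` cross.
      drops-to-closer : g j Fin.< j → g j Fin.< g i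
      drops-to-closer gj<j with m≤n⇒m<n∨m≡n (≤-pred (subst (toℕ (g j) <_) j≡1+i gj<j))
      ... | inj₂ gj≡i = subst (g j Fin.<_)
        (trans (sym (inv j)) (cong g (toℕ-injective gj≡i))) gj<j
      ... | inj₁ gj<i with <-≤-connex (toℕ (g i)) (toℕ i)
      ...   | inj₂ i≤gi = <-≤-trans gj<i i≤gi
      ...   | inj₁ gi<i with <-cmp (toℕ (g j)) (toℕ (g i))
      ...     | tri< lt _ _ = lt
      ...     | tri≈ _ eq _ = contradiction
        (cong toℕ (involutive⇒injective (toℕ-injective eq))) (>⇒≢ i<j)
      ...     | tri> _ _ gi<gj = contradiction (subst₂ Fin._<_ (sym (inv i)) (sym (inv j)) i<j)
        (nc (g i) (g j) gi<gj (subst (g j Fin.<_) (sym (inv i)) gj<i))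

      descent⇒drop : ∀ {x y} → Kind x (toℕ i) (toℕ (g i)) → Kind y (toℕ j) (toℕ (g j)) →
                     Descent x y → g j Fin.< g i
      descent⇒drop (opener i<gi) _             _ = drops-after-opener i<gi
      descent⇒drop _             (closer gj<j) _ = drops-to-closer gj<j
      descent⇒drop (closer _)    (opener _)    (inj₁ ())
      descent⇒drop (closer _)    (opener _)    (inj₂ ())
      descent⇒drop (closer _)    (fixed _)     (inj₁ ())
      descent⇒drop (closer _)    (fixed _)     (inj₂ ())
      descent⇒drop (fixed _)     (opener _)    (inj₁ ())
      descent⇒drop (fixed _)     (opener _)    (inj₂ ())
      descent⇒drop (fixed _)     (fixed _)     (inj₁ ())
      descent⇒drop (fixed _)     (fixed _)     (inj₂ ())

      -- In the remaining cases `g i ≤ i < j ≤ g j`.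
      drop⇒descent : ∀ {x y} → Kind x (toℕ i) (toℕ (g i)) → Kind y (toℕ j) (toℕ (g j)) →
                     g j Fin.< g i → Descent x y
      drop⇒descent (opener _) _          _ = inj₁ refl
      drop⇒descent _          (closer _) _ = inj₂ refl
      drop⇒descent (closer gi<i) (opener j<gj) lt = contradiction lt (<-asym (<-trans gi<i (<-trans i<j j<gj)))
      drop⇒descent (closer gi<i) (fixed j≡gj)  lt = contradiction lt (<-asym (<-trans gi<i (subst (toℕ i <_) j≡gj i<j)))
      drop⇒descent (fixed i≡gi)  (opener j<gj) lt = contradiction lt (<-asym (subst (_< _) i≡gi (<-trans i<j j<gj)))
      drop⇒descent (fixed i≡gi)  (fixed j≡gj)  lt = contradiction lt (<-asym (subst₂ _<_ i≡gi j≡gj i<j))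

      drop⇔descent : g j Fin.< g i ⇔ Descent (lookup (arcWord g) i) (lookup (arcWord g) j)
      drop⇔descent = mk⇔ (drop⇒descent (arcWord-kind g i) (arcWord-kind g j))
                         (descent⇒drop (arcWord-kind g i) (arcWord-kind g j))

      drop∨climb : g j Fin.< g i ⊎ g i Fin.< g j
      drop∨climb with <-cmp (toℕ (g i)) (toℕ (g j))
      ... | tri< lt _ _ = inj₂ lt
      ... | tri≈ _ eq _ = contradiction
        (cong toℕ (involutive⇒injective (toℕ-injective eq))) (<⇒≢ i<j)
      ... | tri> _ _ gt = inj₁ gt

module _ {f g : Fin m → Fin m} (same : arcWord f ≡ arcWord g) where

  same-kinds : ∀ i → ∃[ x ] Kind x (toℕ i) (toℕ (f i)) × Kind x (toℕ i) (toℕ (g i))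
  same-kinds i = lookup (arcWord f) i , arcWord-kind f i ,
    subst (λ w → Kind (lookup w i) (toℕ i) (toℕ (g i))) (sym same) (arcWord-kind g i)

  opener⇒opener : ∀ i → i Fin.< f i → i Fin.< g i
  opener⇒opener i i<fi with same-kinds i
  ... | _ , opener _    , opener i<gi = i<gi
  ... | _ , closer fi<i , _           = contradiction i<fi (<-asym fi<i)
  ... | _ , fixed i≡fi  , _           = contradiction i≡fi (<⇒≢ i<fi)

  closer⇒closer : ∀ i → f i Fin.< i → g i Fin.< i
  closer⇒closer i fi<i with same-kinds i
  ... | _ , opener i<fi , _           = contradiction i<fi (<-asym fi<i)
  ... | _ , closer _    , closer gi<i = gi<i
  ... | _ , fixed i≡fi  , _           = contradiction i≡fi (>⇒≢ fi<i)

-- If two noncrossing involutions with the same word first disagree at the closer j, with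
-- f j < g j = a say, then the arc from a in f is nested in the arc from f j to j, so it
-- closes before j, and there g must agree with f.
firstDisagreement-≮ : {f g : Fin m → Fin m} → (∀ i → f (f i) ≡ i) → (∀ i → g (g i) ≡ i) →
  NonCrossing f → arcWord g ≡ arcWord f →
  ∀ j → (∀ c → c Fin.< j → f c Fin.< c → f c ≡ g c) → g j Fin.< j → ¬ f j Fin.< g j
firstDisagreement-≮ {m} {f} {g} f-inv g-inv nc same j agree gj<j fj<gj = contradiction
  (trans (sym (g-inv c)) (trans (cong g (sym fc≡gc)) (trans (cong g (f-inv a)) (g-inv j))))
  (λ c≡j → <⇒≢ c<j (cong toℕ c≡j))
  where
  a c : Fin m
  a = g j
  c = f a

  c<j : c Fin.< j
  c<j = closer-outside f-inv nc a j fj<gj gj<j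

  fc≡gc : f c ≡ g c
  fc≡gc = agree c c<j (subst (Fin._< c) (sym (f-inv a))
    (opener⇒opener same a (subst (a Fin.<_) (sym (g-inv j)) gj<j)))

-- Well-founded induction on the closer: `firstDisagreement-≮`, applied with `f` and `g` in both
-- roles, excludes both strict orders.
closers-agree : {f g : Fin m → Fin m} → (∀ i → f (f i) ≡ i) → (∀ i → g (g i) ≡ i) →
  NonCrossing f → NonCrossing g → arcWord f ≡ arcWord g → ∀ j → f j Fin.< j → f j ≡ g j
closers-agree {f = f} {g} f-inv g-inv f-nc g-nc same j = go j (<-wellFounded j)
  where
  go : ∀ j → Acc Fin._<_ j → f j Fin.< j → f j ≡ g j
  go j (acc rs) fj<j with <-cmp (toℕ (f j)) (toℕ (g j))
  ... | tri< fj<gj _ _ = contradiction fj<gj (firstDisagreement-≮ f-inv g-inv f-nc (sym same) j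
    (λ c c<j → go c (rs c<j)) (closer⇒closer same j fj<j))
  ... | tri≈ _ eq _    = toℕ-injective eq
  ... | tri> _ _ gj<fj = contradiction gj<fj (firstDisagreement-≮ g-inv f-inv g-nc same j
    (λ c c<j gc<c → sym (go c (rs c<j) (closer⇒closer (sym same) c gc<c))) fj<j)

-- Every opener is the partner of a closer, so agreement at closers carries over to openers.
arcWord-injective : {f g : Fin m → Fin m} → (∀ i → f (f i) ≡ i) → (∀ i → g (g i) ≡ i) →
  NonCrossing f → NonCrossing g → arcWord f ≡ arcWord g → ∀ i → f i ≡ g i
arcWord-injective {f = f} {g} f-inv g-inv f-nc g-nc same i with same-kinds same i
... | _ , fixed i≡fi  , fixed i≡gi = toℕ-injective (trans (sym i≡fi) i≡gi)
... | _ , closer fi<i , _          = closers-agree f-inv g-inv f-nc g-nc same i fi<i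
... | _ , opener i<fi , _          =
  trans (sym (g-inv (f i))) (cong g (trans (sym ffi≡gfi) (f-inv i)))
  where
  ffi≡gfi : f (f i) ≡ g (f i)
  ffi≡gfi = closers-agree f-inv g-inv f-nc g-nc same (f i) (subst (Fin._< f i) (sym (f-inv i)) i<fi)

module _ {w : Vec Step m} (p : IsMotzkin w) where
  open Arcs p

  match-nonCrossing : NonCrossing match
  match-nonCrossing a c a<c c<b b<d =
    arcs-don't-cross (match-arc a (<-trans a<c c<b)) (match-arc c (<-trans c<b b<d)) a<c c<b b<d

  -- Heights rise at the left end of an arc, fall at its right end and stay level at a fixed point,
  -- which determines the step of `w`.
  arcWord-match : arcWord match ≡ w
  arcWord-match = trans (tabulate-cong same-letter) (tabulate∘lookup w)
    where
    move : ∀ i → Kind (lookup w i) (height p (toℕ i)) (height p (suc (toℕ i)))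
    move i = move-kind (height-move p i)

    same-letter : ∀ i → letter (toℕ i) (toℕ (match i)) ≡ lookup w i
    same-letter i with match-partner i
    ... | opens arc     = trans (kind-unique (letter-kind _ _) (opener (proj₁ arc)))
                                (kind-unique (opener (arc-rises arc)) (move i))
    ... | closes arc    = trans (kind-unique (letter-kind _ _) (closer (proj₁ arc)))
                                (kind-unique (closer (arc-falls arc)) (move i))
    ... | fixed eq i≡j  = trans (kind-unique (letter-kind _ _) (fixed i≡j))
                                (kind-unique (fixed eq) (move i))

-- Avoiding 3412

strictMono⇒reflects : ∀ {ι : Fin k → Fin m} → (∀ {r s} → r Fin.< s → ι r Fin.< ι s) →
                      ∀ r s → ι r Fin.< ι s → r Fin.< s
strictMono⇒reflects {ι = ι} mono r s ιr<ιs with <-cmp (toℕ r) (toℕ s)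
... | tri< r<s _ _ = r<s
... | tri≈ _ r≡s _ = contradiction (cong (toℕ ∘ ι) (toℕ-injective r≡s)) (<⇒≢ ιr<ιs)
... | tri> _ _ s<r = contradiction ιr<ιs (<-asym (mono s<r))

module _ (π : Permutation′ m) (inv : ∀ i → π ⟨$⟩ʳ (π ⟨$⟩ʳ i) ≡ i) where

  private
    g : Fin m → Fin m
    g = π ⟨$⟩ʳ_

  -- A crossing is an occurrence at positions `a`, `c`, `g a`, `g c`, with values `g a`, `g c`, `a`,
  -- `c`.
  avoids⇒nonCrossing : Avoids 3412-pattern π → NonCrossing g
  avoids⇒nonCrossing avoids a c a<c c<ga ga<gc = avoids
    -- `g` permutes these points as `τ` permutes their indices, so the order of values reduces to
    -- monotonicity of `ι`.
    (ι , mono , λ r s → subst₂ (λ x y → x Fin.< y ⇔ τ r Fin.< τ s) (sym (g∘ι r)) (sym (g∘ι s))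
      (mk⇔ (strictMono⇒reflects mono (τ r) (τ s)) mono))
    where
    ι : Fin 4 → Fin m
    ι = lookup (a ∷ c ∷ g a ∷ g c ∷ [])

    τ : Fin 4 → Fin 4
    τ = 3412-pattern ⟨$⟩ʳ_

    mono : ∀ {r s} → r Fin.< s → ι r Fin.< ι s
    mono {0F} {1F} _ = a<c
    mono {0F} {2F} _ = <-trans a<c c<ga
    mono {0F} {3F} _ = <-trans a<c (<-trans c<ga ga<gc)
    mono {1F} {2F} _ = c<ga
    mono {1F} {3F} _ = <-trans c<ga ga<gc
    mono {2F} {3F} _ = ga<gc
    mono {1F} {1F} (s≤s ())
    mono {2F} {1F} (s≤s ())
    mono {2F} {2F} (s≤s (s≤s ()))
    mono {3F} {1F} (s≤s ())
    mono {3F} {2F} (s≤s (s≤s ()))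
    mono {3F} {3F} (s≤s (s≤s (s≤s ())))

    g∘ι : ∀ r → g (ι r) ≡ ι (τ r)
    g∘ι 0F = refl
    g∘ι 1F = refl
    g∘ι 2F = inv a
    g∘ι 3F = inv c

  -- Let i < j < k < l carry the pattern.  If k ≤ g i then the arcs from i and j cross;
  -- otherwise g l < g i < k, and the arcs to k and l cross.
  nonCrossing⇒avoids : NonCrossing g → Avoids 3412-pattern π
  nonCrossing⇒avoids nc (ι , mono , order) with <-≤-connex (toℕ (g (ι 0F))) (toℕ (ι 2F))
  ... | inj₂ k≤gi = nc (ι 0F) (ι 1F) (mono (s≤s z≤n)) (<-≤-trans (mono (s≤s (s≤s z≤n))) k≤gi)
    (Equivalence.from (order 0F 1F) (s≤s (s≤s (s≤s z≤n))))
  ... | inj₁ gi<k = nc (g (ι 2F)) (g (ι 3F)) (Equivalence.from (order 2F 3F) (s≤s z≤n))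
    (subst (g (ι 3F) Fin.<_) (sym (inv (ι 2F)))
      (<-trans (Equivalence.from (order 3F 0F) (s≤s (s≤s z≤n))) gi<k))
    (subst₂ Fin._<_ (sym (inv (ι 2F))) (sym (inv (ι 3F))) (mono (s≤s (s≤s (s≤s z≤n)))))

-- Restricting the bijection to alternating involutions

involutive : (π : Permutation′ m) → Involution π → ∀ i → π ⟨$⟩ʳ (π ⟨$⟩ʳ i) ≡ i
involutive π inv i = trans (cong (π ⟨$⟩ʳ_) (inv i)) (inverseʳ π)

-- Abstracts from the two kinds of alternation, so that `arcWord-bijection` serves both.
Reflects : Pred (Permutation′ m) 0ℓ → Pred (Vec Step m) 0ℓ → Set
Reflects {m} P Q = (π : Permutation′ m) → (∀ i → π ⟨$⟩ʳ (π ⟨$⟩ʳ i) ≡ i) →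
  NonCrossing (π ⟨$⟩ʳ_) → P π ⇔ Q (arcWord (π ⟨$⟩ʳ_))

arcWord-bijection : {P : Pred (Permutation′ m) 0ℓ} {Q : Pred (Vec Step m) 0ℓ} → Reflects P Q →
  Bijection (Subset m (P ∩ Involution ∩ Avoids 3412-pattern)) (Words m (IsMotzkin ∩ Q))
arcWord-bijection {P = P} {Q} P⇔Q = record
  { to        = λ (π , Pπ , inv , avoids) → arcWord (π ⟨$⟩ʳ_) ,
      arcWord-motzkin (involutive π inv) ,
      Equivalence.to (P⇔Q π (involutive π inv) (avoids⇒nonCrossing π (involutive π inv) avoids)) Pπ
  ; cong      = arcWord-cong
  ; bijective = (λ {(π , _ , inv , avoids)} {(ρ , _ , inv′ , avoids′)} →
      arcWord-injective (involutive π inv) (involutive ρ inv′)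
        (avoids⇒nonCrossing π (involutive π inv) avoids)
        (avoids⇒nonCrossing ρ (involutive ρ inv′) avoids′))
    , λ (w , p , q) → let open Arcs p in
      (matching , Equivalence.from (P⇔Q matching match-involutive (match-nonCrossing p))
          (subst Q (sym (arcWord-match p)) q) ,
        -- `matching` is built with `match` as its own inverse, so being an involution holds by
        -- computation.
        (λ _ → refl) , nonCrossing⇒avoids matching match-involutive (match-nonCrossing p)) ,
      λ eq → trans (arcWord-cong eq) (arcWord-match p)
  }

-- Turns a parity condition on ascents into the opposite one on descents, and back.
complementary-parities : ∀ {A B : Set} {p} q → A ⊎ B → (A → ¬ B) → A ⇔ p ≡ q → B ⇔ p ≡ q ⁻¹
complementary-parities {p = p} q A∨B A⇒¬B A⇔ = mk⇔
  (λ b → ≢⇒≡⁻¹ p q λ p≡q → A⇒¬B (Equivalence.from A⇔ p≡q) b)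
  (λ p≡q⁻¹ → [ (λ a → contradiction (trans (sym (Equivalence.to A⇔ a)) p≡q⁻¹) (p≢p⁻¹ q)) , id ] A∨B)
  where
  ≢⇒≡⁻¹ : ∀ p q → p ≢ q → p ≡ q ⁻¹
  ≢⇒≡⁻¹ 0ℙ 0ℙ p≢q = contradiction refl p≢q
  ≢⇒≡⁻¹ 0ℙ 1ℙ _   = refl
  ≢⇒≡⁻¹ 1ℙ 0ℙ _   = refl
  ≢⇒≡⁻¹ 1ℙ 1ℙ p≢q = contradiction refl p≢q

reverseAlternating-falls : Reflects {m} ReverseAlternating (Falls 0ℙ)
reverseAlternating-falls π inv nc = mk⇔
  (λ alt i j eq → parity-suc (toℕ i) 1ℙ ⇔-∘ (alt i j eq ⇔-∘ ⇔-sym (drop⇔descent inv nc i j eq)))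
  (λ falls i j eq → ⇔-sym (parity-suc (toℕ i) 1ℙ) ⇔-∘ (falls i j eq ⇔-∘ drop⇔descent inv nc i j eq))

-- Passing from ascents to descents and counting positions from 0 each flip the parity, so it stays
-- `1ℙ`.
alternating-falls : Reflects {m} Alternating (Falls 1ℙ)
alternating-falls π inv nc = mk⇔
  (λ alt i j eq → parity-suc (toℕ i) 0ℙ
    ⇔-∘ (complementary-parities 1ℙ (swap (drop∨climb inv nc i j eq)) <-asym (alt i j eq)
    ⇔-∘ ⇔-sym (drop⇔descent inv nc i j eq)))
  (λ falls i j eq → complementary-parities 0ℙ (drop∨climb inv nc i j eq) <-asym
    (⇔-sym (parity-suc (toℕ i) 0ℙ) ⇔-∘ (falls i j eq ⇔-∘ drop⇔descent inv nc i j eq)))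

-- Lengths and cardinalities

2*n+′k≡2*n+k : ∀ n k → 2* n +′ k ≡ 2 * n + k
2*n+′k≡2*n+k zero    k = refl
2*n+′k≡2*n+k (suc n) k = cong suc (trans (cong suc (2*n+′k≡2*n+k n k))
  (cong (_+ k) (sym (+-suc n (n + 0)))))

count : ∀ {A : Setoid 0ℓ 0ℓ} n {Q : Pred (Vec Step m) 0ℓ} → Bijection A (Words m Q) →
        Bijection (Words n IsMotzkin) (Words m Q) → ∣ A ∣≡ motzkin n
count n A≃W M≃W = inverse (Bijection⇒Inverse A≃W)
  (Symmetry.inverse (Bijection⇒Inverse (bijection (index-Motzkin n) M≃W)))

RAI-count : ∀ n {t : Vec Step k} → Tail t → ∣ RAI (2* n +′ k) 3412-pattern ∣≡ motzkin n
RAI-count n τ = count n (arcWord-bijection reverseAlternating-falls) (expand-bijection n τ)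

-- The prepended `H` adds one to the length: `even` gives 2n+1 and `odd` gives 2n+2.
AI-count : ∀ n {t : Vec Step k} → Tail t → ∣ AI (suc (2* n +′ k)) 3412-pattern ∣≡ motzkin n
AI-count n τ = count n (arcWord-bijection alternating-falls)
  (bijection (expand-bijection n τ) (prepend-bijection _))

theorem6p1 : (n : ℕ) →
    (∣ RAI (2 * n) 3412-pattern ∣≡ motzkin n) ×
    (∣ AI (2 * n + 2) 3412-pattern ∣≡ motzkin n) ×
    (∣ AI (2 * n + 1) 3412-pattern ∣≡ motzkin n) ×
    (∣ RAI (2 * n + 1) 3412-pattern ∣≡ motzkin n)
theorem6p1 n =
  subst (λ l → ∣ RAI l 3412-pattern ∣≡ motzkin n)
    (trans (2*n+′k≡2*n+k n 0) (+-identityʳ (2 * n))) (RAI-count n even) ,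
  subst (λ l → ∣ AI l 3412-pattern ∣≡ motzkin n)
    (trans (cong suc (2*n+′k≡2*n+k n 1)) (sym (+-suc (2 * n) 1))) (AI-count n odd) ,
  subst (λ l → ∣ AI l 3412-pattern ∣≡ motzkin n)
    (trans (cong suc (2*n+′k≡2*n+k n 0)) (sym (+-suc (2 * n) 0))) (AI-count n even) ,
  subst (λ l → ∣ RAI l 3412-pattern ∣≡ motzkin n) (2*n+′k≡2*n+k n 1) (RAI-count n odd)
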